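{- Let $M$ be a delta-matroid over a finite ground set $V$, and let $v\in V$. Then the equicardinal set systems $\min(M)$, $\min(M*v)$, and $\mathrm{minc}(M\mathbin{\bar{*}}v)$ are such that precisely two of the three are equal, to say $M_1$. Moreover, the third, $M_2$, is such that $d_{M_2}=d_{M_1}+1$ and $M_2\mathbin{\widehat{/}}v=M_1$. In particular, the values of $d_M$, $d_{M*v}$, and $d_{M\bar{*}v}$ are such that precisely two of the three are equal, to say $m$, and the third is equal to $m+1$.
   Context: A set system is a pair $M=(V,D)$ with $V$ a finite set (the ground set) and $D$ a family of subsets of $V$; it is proper if $D\neq\varnothing$. We write $Y\in M$ for $Y\in D$. $\triangle$ denotes symmetric difference. A set system is equicardinal if all its sets have the same cardinality. A delta-matroid is a proper set system $M$ satisfying the symmetric exchange axiom: for all $X,Y\in M$ and all $u\in X\triangle Y$, either $X\triangle\{u\}\in M$ or there is a $w\in X\triangle Y$ with $w\neq u$ such that $X\triangle\{u,w\}\in M$. For $v\in V$: the pivot of $M$ on $v$ is $M*v=(V,\{Y\triangle\{v\}\mid Y\in D\})$; the dual pivot of $M$ on $v$ is $M\mathbin{\bar{*}}v=(V,D\triangle\{Z\setminus\{v\}\mid Z\in D,\ v\in Z\})$; the pseudo-contraction of $M$ on $v$ is $M\mathbin{\widehat{/}}v=(V,\{Z\setminus\{v\}\mid Z\in D,\ v\in Z\})$ (with ground set still $V$). $\min(M)$ is the set system on $V$ consisting of the members of $D$ that are minimal with respect to inclusion; $\mathrm{minc}(M)$ is the set system on $V$ consisting of the members of $D$ of minimum cardinality.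 For a proper set system $M$, $d_M=\min\{|Y|\mid Y\in M\}$ is the cardinality of a smallest set in $M$. -}

module Defs where

open import Data.Bool.Base using (_xor_)
open import Data.Bool.Properties as Bool using ()
open import Data.Fin.Base using (Fin)
open import Data.Fin.Subset using (Subset; _∈_; _⊂_; _∪_; _-_; ⁅_⁆; ∣_∣)
open import Data.Fin.Subset.Properties using (_∈?_; _⊂?_; anySubset?; p⊂q⇒∣p∣<∣q∣)
open import Data.Nat.Base using (ℕ; suc; _≤_; _<_; s≤s⁻¹)
open import Data.Nat.Properties using (_≤?_; ≰⇒>; ≤-refl; ≤-trans; <⇒≱)
open import Data.Product.Base using (∃; _×_; _,_; proj₁)
open import Data.Sum.Base using (_⊎_; inj₁; inj₂)
open import Data.Vec.Base using (zipWith; _∷_; there)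
open import Data.Vec.Properties using (≡-dec)
open import Level using (0ℓ; _⊔_)
open import Relation.Binary.Core using (Rel)
open import Relation.Binary.PropositionalEquality using (_≡_; _≢_; refl)
open import Relation.Nullary using (Dec; yes; no; ¬_)
open import Relation.Nullary.Decidable using (¬?; _×-dec_; _⊎-dec_; map′; decidable-stable)
open import Relation.Unary using (Pred; Decidable; _≐_)

infix  4 _∈ˢ_ _∈ˢ?_ _≈_
infixl 6 _△_ _△ˢ_
infixl 7 _*_ _*ᵈ_ _/ᵖ_

private
  variable
    n : ℕ

_△_ : Subset n → Subset n → Subset n
_△_ = zipWith _xor_

-- The ground set is Fin n.  Decidability of the family makes it a genuine
-- element of the power set of the power set of Fin n, so that classical case
-- distinctions on membership are available.
record SetSystem (n : ℕ) : Set₁ where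
  field
    Member  : Pred (Subset n) 0ℓ
    member? : Decidable Member

open SetSystem

_∈ˢ_ : Subset n → SetSystem n → Set
Y ∈ˢ M = Member M Y

_∈ˢ?_ : (Y : Subset n) (M : SetSystem n) → Dec (Y ∈ˢ M)
Y ∈ˢ? M = member? M Y

_≈_ : Rel (SetSystem n) 0ℓ
M ≈ N = Member M ≐ Member N

Proper : SetSystem n → Set
Proper M = ∃ λ Y → Y ∈ˢ M

Equicardinal : SetSystem n → Set
Equicardinal M = ∀ {Y Z} → Y ∈ˢ M → Z ∈ˢ M → ∣ Y ∣ ≡ ∣ Z ∣

record IsDeltaMatroid (M : SetSystem n) : Set where
  field
    proper   : Proper M
    exchange : ∀ {X Y} → X ∈ˢ M → Y ∈ˢ M → ∀ {u} → u ∈ X △ Y →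
               (X △ ⁅ u ⁆ ∈ˢ M) ⊎
               (∃ λ w → w ∈ X △ Y × w ≢ u × X △ (⁅ u ⁆ ∪ ⁅ w ⁆) ∈ˢ M)

private
  _≟ˢ_ : (Y Z : Subset n) → Dec (Y ≡ Z)
  _≟ˢ_ = ≡-dec Bool._≟_

  allMembers? : (M : SetSystem n) {P : Pred (Subset n) 0ℓ} → Decidable P →
                Dec (∀ {Z} → Z ∈ˢ M → P Z)
  allMembers? M P? = map′
    (λ none {Z} Z∈M → decidable-stable (P? Z) (λ ¬p → none (Z , Z∈M , ¬p)))
    (λ all → λ { (Z , Z∈M , ¬p) → ¬p (all Z∈M) })
    (¬? (anySubset? (λ Z → (Z ∈ˢ? M) ×-dec ¬? (P? Z))))

_△ˢ_ : SetSystem n → SetSystem n → SetSystem n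
Member  (M △ˢ N) Y = (Y ∈ˢ M × ¬ Y ∈ˢ N) ⊎ (¬ Y ∈ˢ M × Y ∈ˢ N)
member? (M △ˢ N) Y =
  ((Y ∈ˢ? M) ×-dec ¬? (Y ∈ˢ? N)) ⊎-dec (¬? (Y ∈ˢ? M) ×-dec (Y ∈ˢ? N))

-- M * v, M /ᵖ v and M *ᵈ v are the pivot, the pseudo-contraction and the dual
-- pivot of M on v; the pseudo-contraction keeps v in the ground set.
_*_ : SetSystem n → Fin n → SetSystem n
Member  (M * v) Z = ∃ λ Y → Y ∈ˢ M × Z ≡ Y △ ⁅ v ⁆
member? (M * v) Z = anySubset? λ Y → (Y ∈ˢ? M) ×-dec (Z ≟ˢ (Y △ ⁅ v ⁆))

_/ᵖ_ : SetSystem n → Fin n → SetSystem n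
Member  (M /ᵖ v) Y = ∃ λ Z → Z ∈ˢ M × v ∈ Z × Y ≡ Z - v
member? (M /ᵖ v) Y =
  anySubset? λ Z → (Z ∈ˢ? M) ×-dec (v ∈? Z) ×-dec (Y ≟ˢ (Z - v))

_*ᵈ_ : SetSystem n → Fin n → SetSystem n
M *ᵈ v = M △ˢ (M /ᵖ v)

min : SetSystem n → SetSystem n
Member  (min M) Y = Y ∈ˢ M × (∀ {Z} → Z ∈ˢ M → ¬ Z ⊂ Y)
member? (min M) Y = (Y ∈ˢ? M) ×-dec allMembers? M (λ Z → ¬? (Z ⊂? Y))

minc : SetSystem n → SetSystem n
Member  (minc M) Y = Y ∈ˢ M × (∀ {Z} → Z ∈ˢ M → ∣ Y ∣ ≤ ∣ Z ∣)
member? (minc M) Y = (Y ∈ˢ? M) ×-dec allMembers? M (λ Z → ∣ Y ∣ ≤? ∣ Z ∣)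

minc-proper : (M : SetSystem n) → Proper M → Proper (minc M)
minc-proper {n} M (Y , Y∈M) = descend (suc ∣ Y ∣) Y Y∈M ≤-refl
  where
  descend : ∀ k (X : Subset n) → X ∈ˢ M → ∣ X ∣ < k → Proper (minc M)
  descend (suc k) X X∈M X<k
    with anySubset? (λ Z → (Z ∈ˢ? M) ×-dec (suc ∣ Z ∣ ≤? ∣ X ∣))
  ... | yes (Z , Z∈M , Z<X) = descend k Z Z∈M (≤-trans Z<X (s≤s⁻¹ X<k))
  ... | no none = X , X∈M , λ {Z} Z∈M →
    decidable-stable (∣ X ∣ ≤? ∣ Z ∣) (λ X≰Z → none (Z , Z∈M , ≰⇒> X≰Z))

min-proper : (M : SetSystem n) → Proper M → Proper (min M)
min-proper M p with minc-proper M p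
... | Y , Y∈M , Y≤ = Y , Y∈M , λ Z∈M Z⊂Y → <⇒≱ (p⊂q⇒∣p∣<∣q∣ Z⊂Y) (Y≤ Z∈M)

*-proper : (M : SetSystem n) (v : Fin n) → Proper M → Proper (M * v)
*-proper M v (Y , Y∈M) = Y △ ⁅ v ⁆ , Y , Y∈M , refl

private
  x∉p-x : (x : Fin n) (p : Subset n) → ¬ x ∈ p - x
  x∉p-x Fin.zero    (_ ∷ p) ()
  x∉p-x (Fin.suc x) (_ ∷ p) (there x∈) = x∉p-x x p x∈

*ᵈ-proper : (M : SetSystem n) (v : Fin n) → Proper M → Proper (M *ᵈ v)
*ᵈ-proper M v (Y , Y∈M) with Y ∈ˢ? (M /ᵖ v)
... | no  Y∉            = Y , inj₁ (Y∈M , Y∉)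
... | yes (Z , Z∈M , v∈Z , _) =
  Z , inj₁ (Z∈M , λ { (W , _ , _ , refl) → x∉p-x v W v∈Z })

-- The cardinality of a smallest member; its value does not depend on which
-- smallest member the search returns, nor on the proof of properness.
d : (M : SetSystem n) → Proper M → ℕ
d M p = ∣ proj₁ (minc-proper M p) ∣

record ProperSetSystem (n : ℕ) : Set₁ where
  constructor ⟨_,_⟩
  field
    system : SetSystem n
    proper : Proper system

-- Precisely two of x, y, z are equal, and R relates their common value
-- (first argument) to the third one (second argument).
module _ {a ℓ r} {A : Set a} (_∼_ : Rel A ℓ) (R : Rel A r) where

  TwoEqual∣Third : A → A → A → Set (ℓ ⊔ r)
  TwoEqual∣Third x y z = (x ∼ y) × (¬ (x ∼ z)) × (¬ (y ∼ z)) × R x z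

  PreciselyTwoEqual : A → A → A → Set (ℓ ⊔ r)
  PreciselyTwoEqual x y z =
    TwoEqual∣Third x y z ⊎ TwoEqual∣Third x z y ⊎ TwoEqual∣Third y z x

_≈ᵖ_ : Rel (ProperSetSystem n) 0ℓ
⟨ M , _ ⟩ ≈ᵖ ⟨ N , _ ⟩ = M ≈ N

LiesAbove : Fin n → Rel (ProperSetSystem n) 0ℓ
LiesAbove v ⟨ M₁ , p₁ ⟩ ⟨ M₂ , p₂ ⟩ =
  d M₂ p₂ ≡ suc (d M₁ p₁) × (M₂ /ᵖ v) ≈ M₁

{-# OPTIONS --safe #-}

-- In a delta-matroid every member contains a member of minimum cardinality:
-- among the minimum-cardinality members take one, Y, closest to X; an element of
-- Y \ X could be exchanged for an element of X \ Y, bringing Y closer to X.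
-- Hence min = minc, and everything is decided by comparing d_M with d_{M*v}.
-- If they differ, say d_M < d_{M*v}, the smallest members of M avoid v, survive
-- in the dual pivot, and adding v to them gives smallest members of M*v.  If
-- they agree, the containment applied to X ∪ {v} shows that M and M*v have the
-- same smallest members, so these all cancel in the dual pivot.
module Submission where

open import Defs
open import Data.Bool.Properties using (xor-assoc; xor-comm; xor-identityʳ; xor-same)
open import Data.Nat.Base using (ℕ; suc; _≤_; _<_; s≤s⁻¹)
open import Data.Nat.Properties
  using (≤-refl; ≤-reflexive; ≤-trans; ≤-antisym; <⇒≤; <⇒≱; <⇒≢; ≤∧≢⇒<; <-cmp;
         n<1+n; suc-injective; module ≤-Reasoning)
open import Data.Fin.Base using (Fin; zero; suc)
open import Data.Fin.Properties using (any?)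
open import Data.Fin.Subset
  using (Subset; inside; outside; _∈_; _∉_; _⊆_; _∪_; _-_; ⁅_⁆; ∣_∣)
  renaming (⊥ to ∅)
open import Data.Fin.Subset.Properties
  using (_∈?_; x∈⁅x⁆; x∈⁅y⁆⇒x≡y; x≢y⇒x∉⁅y⁆; ⊆-antisym; p⊂q⇒∣p∣<∣q∣; p─⊥≡p; drop-there;
         drop-not-there; ∪-identityˡ; ∪-identityʳ)
open import Data.Product.Base using (∃; _×_; _,_; proj₁; proj₂)
open import Data.Sum.Base using (_⊎_; inj₁; inj₂; swap)
open import Data.Vec.Base using ([]; _∷_; here; there)
open import Data.Vec.Properties using (zipWith-assoc; zipWith-comm; zipWith-identityʳ)
open import Function.Base using (_∘_; case_of_)
open import Level using (0ℓ)
open import Relation.Binary.Definitions using (tri<; tri≈; tri>)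
open import Relation.Binary.PropositionalEquality
  using (_≡_; _≢_; refl; sym; trans; cong; cong₂; subst; module ≡-Reasoning)
open import Relation.Nullary using (yes; no; ¬_; contradiction)
open import Relation.Nullary.Decidable using (¬?; _×-dec_; decidable-stable)
open import Relation.Unary using (Pred; _≐_)
open import Relation.Unary.Properties using (≐-sym; ≐-trans)

open SetSystem
open ProperSetSystem using (system)

private
  variable
    n k m l e : ℕ
    p q : Subset n
    u v w : Fin n

-- Symmetric difference and toggling a single element

△-identityʳ : (p : Subset n) → p △ ∅ ≡ p
△-identityʳ = zipWith-identityʳ xor-identityʳ

△-self : (p : Subset n) → p △ p ≡ ∅
△-self []      = refl
△-self (x ∷ p) = cong₂ _∷_ (xor-same x) (△-self p)

△-assoc : (p q r : Subset n) → p △ q △ r ≡ p △ (q △ r)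
△-assoc = zipWith-assoc xor-assoc

△-comm : (p q : Subset n) → p △ q ≡ q △ p
△-comm = zipWith-comm xor-comm

△-cancelʳ : (p q : Subset n) → p △ q △ q ≡ p
△-cancelʳ p q = begin
  p △ q △ q   ≡⟨ △-assoc p q q ⟩
  p △ (q △ q) ≡⟨ cong (p △_) (△-self q) ⟩
  p △ ∅       ≡⟨ △-identityʳ p ⟩
  p           ∎
  where open ≡-Reasoning

△-swapʳ : (p q r : Subset n) → p △ q △ r ≡ p △ r △ q
△-swapʳ p q r = begin
  p △ q △ r   ≡⟨ △-assoc p q r ⟩
  p △ (q △ r) ≡⟨ cong (p △_) (△-comm q r) ⟩
  p △ (r △ q) ≡⟨ △-assoc p r q ⟨
  p △ r △ q   ∎
  where open ≡-Reasoning

△-cancel-common : (p q r : Subset n) → (p △ r) △ (q △ r) ≡ p △ q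
△-cancel-common p q r = begin
  (p △ r) △ (q △ r) ≡⟨ △-assoc (p △ r) q r ⟨
  p △ r △ q △ r     ≡⟨ cong (_△ r) (△-swapʳ p r q) ⟩
  p △ q △ r △ r     ≡⟨ △-cancelʳ (p △ q) r ⟩
  p △ q             ∎
  where open ≡-Reasoning

x∈p△q⁻ : (p q : Subset n) → u ∈ p △ q → (u ∈ p × u ∉ q) ⊎ (u ∉ p × u ∈ q)
x∈p△q⁻ (inside  ∷ p) (outside ∷ q) here = inj₁ (here , λ ())
x∈p△q⁻ (outside ∷ p) (inside  ∷ q) here = inj₂ ((λ ()) , here)
x∈p△q⁻ (_ ∷ p) (_ ∷ q) (there u∈) with x∈p△q⁻ p q u∈
... | inj₁ (u∈p , u∉q) = inj₁ (there u∈p , u∉q ∘ drop-there)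
... | inj₂ (u∉p , u∈q) = inj₂ (u∉p ∘ drop-there , there u∈q)

x∈p△q⁺ˡ : (p q : Subset n) → u ∈ p → u ∉ q → u ∈ p △ q
x∈p△q⁺ˡ (_ ∷ p) (outside ∷ q) here        u∉q = here
x∈p△q⁺ˡ (_ ∷ p) (inside  ∷ q) here        u∉q = contradiction here u∉q
x∈p△q⁺ˡ (_ ∷ p) (_ ∷ q)       (there u∈p) u∉q = there (x∈p△q⁺ˡ p q u∈p (drop-not-there u∉q))

x∈p△q⁺ʳ : (p q : Subset n) → u ∉ p → u ∈ q → u ∈ p △ q
x∈p△q⁺ʳ p q u∉p u∈q = subst (_ ∈_) (△-comm q p) (x∈p△q⁺ˡ q p u∈q u∉p)

u∈p△⁅w⁆⇒u∈p : u ≢ w → u ∈ p △ ⁅ w ⁆ → u ∈ p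
u∈p△⁅w⁆⇒u∈p {w = w} {p = p} u≢w u∈ with x∈p△q⁻ p ⁅ w ⁆ u∈
... | inj₁ (u∈p , _) = u∈p
... | inj₂ (_ , u∈w) = contradiction (x∈⁅y⁆⇒x≡y w u∈w) u≢w

u∈p⇒u∈p△⁅w⁆ : u ≢ w → u ∈ p → u ∈ p △ ⁅ w ⁆
u∈p⇒u∈p△⁅w⁆ u≢w u∈p = x∈p△q⁺ˡ _ _ u∈p (x≢y⇒x∉⁅y⁆ u≢w)

x∉p⇒x∈p△⁅x⁆ : u ∉ p → u ∈ p △ ⁅ u ⁆
x∉p⇒x∈p△⁅x⁆ u∉p = x∈p△q⁺ʳ _ _ u∉p (x∈⁅x⁆ _)

∣p△⁅x⁆∣-∉ : u ∉ p → ∣ p △ ⁅ u ⁆ ∣ ≡ suc ∣ p ∣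
∣p△⁅x⁆∣-∉ {u = zero}  {inside  ∷ p} u∉p = contradiction here u∉p
∣p△⁅x⁆∣-∉ {u = zero}  {outside ∷ p} u∉p = cong (suc ∘ ∣_∣) (△-identityʳ p)
∣p△⁅x⁆∣-∉ {u = suc u} {inside  ∷ p} u∉p = cong suc (∣p△⁅x⁆∣-∉ (drop-not-there u∉p))
∣p△⁅x⁆∣-∉ {u = suc u} {outside ∷ p} u∉p = ∣p△⁅x⁆∣-∉ (drop-not-there u∉p)

x∈p⇒x∉p△⁅x⁆ : u ∈ p → u ∉ p △ ⁅ u ⁆
x∈p⇒x∉p△⁅x⁆ {u = u} {p} u∈p u∈ with x∈p△q⁻ p ⁅ u ⁆ u∈
... | inj₁ (_ , u∉u) = u∉u (x∈⁅x⁆ u)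
... | inj₂ (u∉p , _) = u∉p u∈p

∣p△⁅x⁆∣-∈ : u ∈ p → suc ∣ p △ ⁅ u ⁆ ∣ ≡ ∣ p ∣
∣p△⁅x⁆∣-∈ {u = u} {p} u∈p =
  trans (sym (∣p△⁅x⁆∣-∉ (x∈p⇒x∉p△⁅x⁆ u∈p))) (cong ∣_∣ (△-cancelʳ p ⁅ u ⁆))

x∈p⇒p-x≡p△⁅x⁆ : u ∈ p → p - u ≡ p △ ⁅ u ⁆
x∈p⇒p-x≡p△⁅x⁆ {p = _ ∷ p}       here        = cong (outside ∷_) (trans (p─⊥≡p p) (sym (△-identityʳ p)))
x∈p⇒p-x≡p△⁅x⁆ {p = inside  ∷ p} (there u∈p) = cong (inside ∷_) (x∈p⇒p-x≡p△⁅x⁆ u∈p)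
x∈p⇒p-x≡p△⁅x⁆ {p = outside ∷ p} (there u∈p) = cong (outside ∷_) (x∈p⇒p-x≡p△⁅x⁆ u∈p)

x∉p⇒p≡[p△⁅x⁆]-x : u ∉ p → p ≡ (p △ ⁅ u ⁆) - u
x∉p⇒p≡[p△⁅x⁆]-x {u = u} {p} u∉p =
  sym (trans (x∈p⇒p-x≡p△⁅x⁆ (x∉p⇒x∈p△⁅x⁆ u∉p)) (△-cancelʳ p ⁅ u ⁆))

-- Rewrites the two-element exchange as two successive toggles, each changing the cardinality by
-- exactly one.
p△[⁅x⁆∪⁅y⁆]≡p△⁅x⁆△⁅y⁆ : (p : Subset n) → w ≢ u → p △ (⁅ u ⁆ ∪ ⁅ w ⁆) ≡ p △ ⁅ u ⁆ △ ⁅ w ⁆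
p△[⁅x⁆∪⁅y⁆]≡p△⁅x⁆△⁅y⁆ {w = w} {u} p w≢u =
  trans (cong (p △_) (⁅x⁆∪⁅y⁆≡⁅x⁆△⁅y⁆ u w w≢u)) (sym (△-assoc p ⁅ u ⁆ ⁅ w ⁆))
  where
  ⁅x⁆∪⁅y⁆≡⁅x⁆△⁅y⁆ : ∀ {n} (u w : Fin n) → w ≢ u → ⁅ u ⁆ ∪ ⁅ w ⁆ ≡ ⁅ u ⁆ △ ⁅ w ⁆
  ⁅x⁆∪⁅y⁆≡⁅x⁆△⁅y⁆ zero    zero    w≢u = contradiction refl w≢u
  ⁅x⁆∪⁅y⁆≡⁅x⁆△⁅y⁆ zero    (suc w) w≢u =
    cong (inside ∷_) (trans (∪-identityˡ ⁅ w ⁆) (sym (trans (△-comm ∅ ⁅ w ⁆) (△-identityʳ ⁅ w ⁆))))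
  ⁅x⁆∪⁅y⁆≡⁅x⁆△⁅y⁆ (suc u) zero    w≢u =
    cong (inside ∷_) (trans (∪-identityʳ ⁅ u ⁆) (sym (△-identityʳ ⁅ u ⁆)))
  ⁅x⁆∪⁅y⁆≡⁅x⁆△⁅y⁆ (suc u) (suc w) w≢u = cong (outside ∷_) (⁅x⁆∪⁅y⁆≡⁅x⁆△⁅y⁆ u w (w≢u ∘ cong suc))

⊆∧∣q∣≤∣p∣⇒≡ : p ⊆ q → ∣ q ∣ ≤ ∣ p ∣ → p ≡ q
⊆∧∣q∣≤∣p∣⇒≡ {p = p} p⊆q q≤p = ⊆-antisym p⊆q λ {x} x∈q →
  decidable-stable (x ∈? p) λ x∉p → <⇒≱ (p⊂q⇒∣p∣<∣q∣ (p⊆q , x , x∈q , x∉p)) q≤p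

-- Members of minimum cardinality

-- A relational form of `d`: a height is established by one witness and one bound, with no proof of
-- properness in the index.
LowestAt : SetSystem n → ℕ → Set
LowestAt M k = (∃ λ Y → Y ∈ˢ M × ∣ Y ∣ ≡ k) × (∀ {Z} → Z ∈ˢ M → k ≤ ∣ Z ∣)

Layer : SetSystem n → ℕ → Pred (Subset n) 0ℓ
Layer M k Y = Y ∈ˢ M × ∣ Y ∣ ≡ k

lowestAt-d : (M : SetSystem n) (p : Proper M) → LowestAt M (d M p)
lowestAt-d M p with minc-proper M p
... | Y , Y∈M , Y≤ = (Y , Y∈M , refl) , Y≤

lowestAt-unique : {M : SetSystem n} → LowestAt M k → LowestAt M l → k ≡ l
lowestAt-unique ((Y , Y∈M , Y≡k) , k≤) ((Z , Z∈M , Z≡l) , l≤) =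
  ≤-antisym (≤-trans (k≤ Z∈M) (≤-reflexive Z≡l)) (≤-trans (l≤ Y∈M) (≤-reflexive Y≡k))

lowestAt-layer : {M S : SetSystem n} → Member S ≐ Layer M k → LowestAt M k → LowestAt S k
lowestAt-layer (S⊆ , ⊆S) ((Y , Y∈M , Y≡k) , _) =
  (Y , ⊆S (Y∈M , Y≡k) , Y≡k) , λ Z∈S → ≤-reflexive (sym (proj₂ (S⊆ Z∈S)))

layer⇒equicardinal : {M S : SetSystem n} → Member S ≐ Layer M k → Equicardinal S
layer⇒equicardinal (S⊆ , _) Y∈S Z∈S = trans (proj₂ (S⊆ Y∈S)) (sym (proj₂ (S⊆ Z∈S)))

minc-layer : {M : SetSystem n} → LowestAt M k → Member (minc M) ≐ Layer M k
minc-layer ((X , X∈M , X≡k) , k≤) =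
  (λ (Y∈M , Y≤) → Y∈M , ≤-antisym (≤-trans (Y≤ X∈M) (≤-reflexive X≡k)) (k≤ Y∈M)) ,
  (λ { (Y∈M , refl) → Y∈M , k≤ })

-- Minimal members and pivots of delta-matroids

module _ {M : SetSystem n} (δ : IsDeltaMatroid M) where

  open IsDeltaMatroid δ

  contains-lowest : LowestAt M k → ∀ {X} → X ∈ˢ M → ∃ λ Y → Layer M k Y × Y ⊆ X
  contains-lowest {k = k} ((Y₀ , Y₀∈M , Y₀≡k) , k≤) {X} X∈M =
    -- The first argument of `approach` strictly bounds the distance from `Y` to `X` and makes the
    -- recursion structural.
    approach (suc ∣ Y₀ △ X ∣) Y₀ (Y₀∈M , Y₀≡k) ≤-refl
    where
    approach : ∀ j Y → Layer M k Y → ∣ Y △ X ∣ < j → ∃ λ Y → Layer M k Y × Y ⊆ X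
    approach (suc j) Y (Y∈M , refl) Y△X<j
      with any? (λ u → (u ∈? Y) ×-dec ¬? (u ∈? X))
    ... | no none = Y , (Y∈M , refl) , λ {x} x∈Y →
      decidable-stable (x ∈? X) (λ x∉X → none (x , x∈Y , x∉X))
    ... | yes (u , u∈Y , u∉X)
      with exchange Y∈M X∈M (x∈p△q⁺ˡ Y X u∈Y u∉X)
    -- Dropping `u` alone would leave fewer than `k` elements.
    ... | inj₁ Y△u∈M =
      contradiction (k≤ Y△u∈M) (<⇒≱ (≤-reflexive (∣p△⁅x⁆∣-∈ u∈Y)))
    ... | inj₂ (w , w∈Y△X , w≢u , Y△uw∈M)
      with subst (Member M) (p△[⁅x⁆∪⁅y⁆]≡p△⁅x⁆△⁅y⁆ Y w≢u) Y△uw∈M | w ∈? Y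
    -- If `w` also lies in `Y`, both elements are dropped, again falling below `k`.
    ... | Y″∈M | yes w∈Y = contradiction (k≤ Y″∈M) (<⇒≱ (begin-strict
      ∣ Y △ ⁅ u ⁆ △ ⁅ w ⁆ ∣ <⟨ n<1+n _ ⟩
      suc ∣ Y △ ⁅ u ⁆ △ ⁅ w ⁆ ∣ ≡⟨ ∣p△⁅x⁆∣-∈ (u∈p⇒u∈p△⁅w⁆ w≢u w∈Y) ⟩
      ∣ Y △ ⁅ u ⁆ ∣ <⟨ ≤-reflexive (∣p△⁅x⁆∣-∈ u∈Y) ⟩
      ∣ Y ∣ ∎))
      where open ≤-Reasoning
    -- Now `w` enters as `u` leaves: the size stays `k`, while `u` and `w` both disappear from the
    -- difference with `X`.
    ... | Y″∈M | no w∉Y = approach j (Y △ ⁅ u ⁆ △ ⁅ w ⁆)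
      (Y″∈M , trans (∣p△⁅x⁆∣-∉ (w∉Y ∘ u∈p△⁅w⁆⇒u∈p w≢u)) (∣p△⁅x⁆∣-∈ u∈Y))
      (≤-trans closer (s≤s⁻¹ Y△X<j))
      where
      open ≤-Reasoning
      closer : ∣ Y △ ⁅ u ⁆ △ ⁅ w ⁆ △ X ∣ < ∣ Y △ X ∣
      closer = begin-strict
        ∣ Y △ ⁅ u ⁆ △ ⁅ w ⁆ △ X ∣ ≡⟨ cong ∣_∣ (△-swapʳ (Y △ ⁅ u ⁆) ⁅ w ⁆ X) ⟩
        ∣ Y △ ⁅ u ⁆ △ X △ ⁅ w ⁆ ∣ ≡⟨ cong (λ Z → ∣ Z △ ⁅ w ⁆ ∣) (△-swapʳ Y ⁅ u ⁆ X) ⟩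
        ∣ Y △ X △ ⁅ u ⁆ △ ⁅ w ⁆ ∣ <⟨ ≤-reflexive (∣p△⁅x⁆∣-∈ (u∈p⇒u∈p△⁅w⁆ w≢u w∈Y△X)) ⟩
        ∣ Y △ X △ ⁅ u ⁆ ∣         <⟨ ≤-reflexive (∣p△⁅x⁆∣-∈ (x∈p△q⁺ˡ Y X u∈Y u∉X)) ⟩
        ∣ Y △ X ∣                 ∎

  min-layer : LowestAt M k → Member (min M) ≐ Layer M k
  min-layer {k = k} low@(_ , k≤) = to , from
    where
    to : ∀ {X} → X ∈ˢ min M → Layer M k X
    to {X} (X∈M , minimal) with contains-lowest low X∈M
    ... | Y , (Y∈M , Y≡k) , Y⊆X = X∈M , trans (cong ∣_∣ (sym Y≡X)) Y≡k
      where
      Y≡X : Y ≡ X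
      Y≡X = ⊆-antisym Y⊆X λ {x} x∈X →
        decidable-stable (x ∈? Y) λ x∉Y → minimal Y∈M (Y⊆X , x , x∈X , x∉Y)
    from : ∀ {X} → Layer M k X → X ∈ˢ min M
    from (X∈M , refl) = X∈M , λ Z∈M Z⊂X → <⇒≱ (p⊂q⇒∣p∣<∣q∣ Z⊂X) (k≤ Z∈M)

  -- Pivoting both members preserves their symmetric difference and commutes with every exchange, so
  -- the axiom carries over with the same `u` and `w`.
  *-isDeltaMatroid : ∀ v → IsDeltaMatroid (M * v)
  *-isDeltaMatroid v = record { proper = *-proper M v proper ; exchange = exchange* }
    where
    pivot : ∀ X S → X △ S ∈ˢ M → X △ ⁅ v ⁆ △ S ∈ˢ M * v
    pivot X S X△S∈M = X △ S , X△S∈M , △-swapʳ X ⁅ v ⁆ S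
    exchange* : ∀ {X Y} → X ∈ˢ M * v → Y ∈ˢ M * v → ∀ {u} → u ∈ X △ Y →
                (X △ ⁅ u ⁆ ∈ˢ M * v) ⊎
                (∃ λ w → w ∈ X △ Y × w ≢ u × X △ (⁅ u ⁆ ∪ ⁅ w ⁆) ∈ˢ M * v)
    exchange* (X , X∈M , refl) (Y , Y∈M , refl) {u} u∈
      with exchange X∈M Y∈M (subst (u ∈_) (△-cancel-common X Y ⁅ v ⁆) u∈)
    ... | inj₁ X△u∈M = inj₁ (pivot X ⁅ u ⁆ X△u∈M)
    ... | inj₂ (w , w∈ , w≢u , X△uw∈M) = inj₂
      (w , subst (w ∈_) (sym (△-cancel-common X Y ⁅ v ⁆)) w∈ , w≢u , pivot X (⁅ u ⁆ ∪ ⁅ w ⁆) X△uw∈M)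

-- Pseudo-contraction of layers and the shape of the conclusion

-- `Member (M /ᵖ v)` unfolds to `Removed v (Member M)`; on predicates the operation also applies to
-- a single layer.
Removed : Fin n → Pred (Subset n) 0ℓ → Pred (Subset n) 0ℓ
Removed v P Y = ∃ λ Z → P Z × v ∈ Z × Y ≡ Z - v

removed-cong : {P Q : Pred (Subset n) 0ℓ} → P ≐ Q → Removed v P ≐ Removed v Q
removed-cong (P⊆Q , Q⊆P) =
  (λ (Z , Z∈P , rest) → Z , P⊆Q Z∈P , rest) , (λ (Z , Z∈Q , rest) → Z , Q⊆P Z∈Q , rest)

removed-≐ : {P Q : Pred (Subset n) 0ℓ} →
            (∀ {Z} → P Z → v ∈ Z → Q (Z △ ⁅ v ⁆)) →
            (∀ {Y} → Q Y → v ∉ Y × P (Y △ ⁅ v ⁆)) →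
            Removed v P ≐ Q
removed-≐ {v = v} {Q = Q} remove insert =
  (λ { (Z , Z∈P , v∈Z , refl) → subst Q (sym (x∈p⇒p-x≡p△⁅x⁆ v∈Z)) (remove Z∈P v∈Z) }) ,
  (λ {Y} Y∈Q → let v∉Y , Y△v∈P = insert Y∈Q in
    Y △ ⁅ v ⁆ , Y△v∈P , x∉p⇒x∈p△⁅x⁆ v∉Y , x∉p⇒p≡[p△⁅x⁆]-x v∉Y)

-- The theorem for bare layers: `M` and `N` are the agreeing pair and `E` the one above. Free
-- heights let all three arrangements of the systems be instances.
record LayersSplit (v : Fin n) (M : SetSystem n) (m : ℕ) (N : SetSystem n) (l : ℕ)
                   (E : SetSystem n) (e : ℕ) : Set where
  field
    heights : m ≡ l
    layers  : Layer M m ≐ Layer N l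
    above   : e ≡ suc m
    removed : Removed v (Layer E e) ≐ Layer M m

  heights-split : TwoEqual∣Third _≡_ (λ x z → z ≡ suc x) m l e
  heights-split = heights , m≢e , m≢e ∘ trans heights , above
    where
    m≢e : m ≢ e
    m≢e m≡e = <⇒≢ (n<1+n m) (trans m≡e above)

  systems-split : (S T U : ProperSetSystem n) →
    Member (system S) ≐ Layer M m → LowestAt M m →
    Member (system T) ≐ Layer N l → LowestAt N l →
    Member (system U) ≐ Layer E e → LowestAt E e →
    TwoEqual∣Third _≈ᵖ_ (LiesAbove v) S T U
  systems-split ⟨ S , s ⟩ ⟨ T , _ ⟩ ⟨ U , u ⟩ S≐ lowM T≐ lowN U≐ lowE =
    ≐-trans S≐ (≐-trans layers (≐-sym T≐)) ,
    distinct S lowS (proj₁ (proj₂ heights-split)) ,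
    distinct T lowT (proj₁ (proj₂ (proj₂ heights-split))) ,
    trans (height U lowU u) (trans above (cong suc (sym (height S lowS s)))) ,
    ≐-trans (removed-cong U≐) (≐-trans removed (≐-sym S≐))
    where
    lowS = lowestAt-layer {M = M} {S = S} S≐ lowM
    lowT = lowestAt-layer {M = N} {S = T} T≐ lowN
    lowU = lowestAt-layer {M = E} {S = U} U≐ lowE
    height : (R : SetSystem n) → LowestAt R k → (r : Proper R) → d R r ≡ k
    height R lowR r = lowestAt-unique {M = R} (lowestAt-d R r) lowR
    -- A lowest layer is nonempty, so equal systems would share a set of both sizes `k` and `e`.
    distinct : (R : SetSystem n) → LowestAt R k → k ≢ e → ¬ R ≈ U
    distinct R ((X , X∈R , X≡k) , _) k≢e R≈U =
      k≢e (trans (sym X≡k) (proj₂ (proj₁ U≐ (proj₁ R≈U X∈R))))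

-- Comparing the lowest layers of a system and its pivot

-- All that the case d M < d N uses of N = M * v and E = M *ᵈ v; unlike the dual
-- pivot itself, these properties are symmetric in M and N.
record PivotTriple (v : Fin n) (M N E : SetSystem n) : Set where
  field
    pivot  : ∀ {Y} → Y ∈ˢ M → Y △ ⁅ v ⁆ ∈ˢ N
    pivot⁻ : ∀ {Y} → Y ∈ˢ N → Y △ ⁅ v ⁆ ∈ˢ M
    E⊆M⊎N  : ∀ {Y} → Y ∈ˢ E → Y ∈ˢ M ⊎ Y ∈ˢ N
    M∖N⊆E  : ∀ {Y} → v ∉ Y → Y ∈ˢ M → ¬ Y ∈ˢ N → Y ∈ˢ E
    N∖M⊆E  : ∀ {Y} → v ∉ Y → Y ∈ˢ N → ¬ Y ∈ˢ M → Y ∈ˢ E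

  flip : PivotTriple v N M E
  flip = record
    { pivot  = pivot⁻
    ; pivot⁻ = pivot
    ; E⊆M⊎N  = λ Y∈E → swap (E⊆M⊎N Y∈E)
    ; M∖N⊆E  = N∖M⊆E
    ; N∖M⊆E  = M∖N⊆E
    }

module _ {M N E : SetSystem n} (T : PivotTriple v M N E) where

  open PivotTriple T

  -- Otherwise toggling `v` would delete it and produce a member of `N` with fewer than `l`
  -- elements.
  lowest-∌v : (∀ {Z} → Z ∈ˢ N → l ≤ ∣ Z ∣) → ∀ {X} → X ∈ˢ M → ∣ X ∣ ≤ l → v ∉ X
  lowest-∌v l≤ X∈M X≤l v∈X =
    <⇒≱ (≤-reflexive (∣p△⁅x⁆∣-∈ v∈X)) (≤-trans X≤l (l≤ (pivot X∈M)))

  split-< : LowestAt M m → LowestAt N l → LowestAt E e → m < l → LayersSplit v M m E e N l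
  split-< {m} {l} {e} ((X , X∈M , X≡m) , m≤) lowN@(_ , l≤) lowE m<l = record
    { heights = m≡e
    ; layers  = subst (λ k → Layer M m ≐ Layer E k) m≡e (M⊆E , E⊆M)
    ; above   = l≡1+m
    ; removed = removed-≐
        (λ (Z∈N , Z≡l) v∈Z →
          pivot⁻ Z∈N , suc-injective (trans (∣p△⁅x⁆∣-∈ v∈Z) (trans Z≡l l≡1+m)))
        (λ Y@(Y∈M , _) → ∌v Y , pivot Y∈M , raised Y)
    }
    where
    ∌v : ∀ {Y} → Layer M m Y → v ∉ Y
    ∌v (Y∈M , refl) = lowest-∌v l≤ Y∈M (<⇒≤ m<l)
    l≡1+m : l ≡ suc m
    l≡1+m = ≤-antisym
      (≤-trans (l≤ (pivot X∈M)) (≤-reflexive (trans (∣p△⁅x⁆∣-∉ (∌v (X∈M , X≡m))) (cong suc X≡m))))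
      m<l
    raised : ∀ {Y} → Layer M m Y → ∣ Y △ ⁅ v ⁆ ∣ ≡ l
    raised Y@(_ , Y≡m) = trans (∣p△⁅x⁆∣-∉ (∌v Y)) (trans (cong suc Y≡m) (sym l≡1+m))
    -- `N` is empty at height `m`, so there nothing cancels in `E` and nothing is added to it.
    ∉N : ∀ {Y} → ∣ Y ∣ ≡ m → ¬ Y ∈ˢ N
    ∉N refl Y∈N = <⇒≱ m<l (l≤ Y∈N)
    M⊆E : ∀ {Y} → Layer M m Y → Layer E m Y
    M⊆E Y@(Y∈M , Y≡m) = M∖N⊆E (∌v Y) Y∈M (∉N Y≡m) , Y≡m
    E⊆M : ∀ {Y} → Layer E m Y → Layer M m Y
    E⊆M (Y∈E , Y≡m) with E⊆M⊎N Y∈E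
    ... | inj₁ Y∈M = Y∈M , Y≡m
    ... | inj₂ Y∈N = contradiction Y∈N (∉N Y≡m)
    m≤E : ∀ {Y} → Y ∈ˢ E → m ≤ ∣ Y ∣
    m≤E Y∈E with E⊆M⊎N Y∈E
    ... | inj₁ Y∈M = m≤ Y∈M
    ... | inj₂ Y∈N = ≤-trans (<⇒≤ m<l) (l≤ Y∈N)
    m≡e : m ≡ e
    m≡e = lowestAt-unique {M = E} ((X , M⊆E (X∈M , X≡m)) , m≤E) lowE

module _ {M N E : SetSystem n} (T : PivotTriple v M N E) where

  open PivotTriple T

  -- A smallest X ∈ M avoids v; a smallest member of N inside X ∪ {v} ∈ N avoids
  -- v too, hence is X.
  layer-⊆ : IsDeltaMatroid N → LowestAt M k → LowestAt N k → ∀ {X} → Layer M k X → X ∈ˢ N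
  layer-⊆ δN (_ , k≤M) lowN@(_ , k≤N) {X} (X∈M , refl)
    with contains-lowest δN lowN (pivot X∈M)
  ... | Y , (Y∈N , Y≡k) , Y⊆X△v = subst (Member N) Y≡X Y∈N
    where
    Y≡X : Y ≡ X
    Y≡X = ⊆∧∣q∣≤∣p∣⇒≡
      (λ x∈Y → u∈p△⁅w⁆⇒u∈p
        (λ { refl → lowest-∌v flip k≤M Y∈N (≤-reflexive Y≡k) x∈Y })
        (Y⊆X△v x∈Y))
      (≤-reflexive (sym Y≡k))

-- The dual pivot and the three cases

∈-* : (M : SetSystem n) (v : Fin n) {Y : Subset n} → Y ∈ˢ M * v → Y △ ⁅ v ⁆ ∈ˢ M
∈-* M v (X , X∈M , refl) = subst (Member M) (sym (△-cancelʳ X ⁅ v ⁆)) X∈M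

module _ (M : SetSystem n) (v : Fin n) where

  private
    N = M * v
    E = M *ᵈ v

  -- With the converse below, this identifies `M /ᵖ v` as the part of `M * v` avoiding `v`, so the
  -- dual pivot can be described through `M` and `M * v`.
  ∈-/ᵖ⇒∈-* : ∀ {Y} → Y ∈ˢ M /ᵖ v → v ∉ Y × Y ∈ˢ N
  ∈-/ᵖ⇒∈-* (Z , Z∈M , v∈Z , refl) =
    subst (v ∉_) (sym (x∈p⇒p-x≡p△⁅x⁆ v∈Z)) (x∈p⇒x∉p△⁅x⁆ v∈Z) , Z , Z∈M , x∈p⇒p-x≡p△⁅x⁆ v∈Z

  ∈-*⇒∈-/ᵖ : ∀ {Y} → v ∉ Y → Y ∈ˢ N → Y ∈ˢ M /ᵖ v
  ∈-*⇒∈-/ᵖ {Y} v∉Y Y∈N =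
    Y △ ⁅ v ⁆ , ∈-* M v Y∈N , x∉p⇒x∈p△⁅x⁆ v∉Y , x∉p⇒p≡[p△⁅x⁆]-x v∉Y

  pivotTriple : PivotTriple v M N E
  pivotTriple = record
    { pivot  = λ {Y} Y∈M → Y , Y∈M , refl
    ; pivot⁻ = ∈-* M v
    ; E⊆M⊎N  = λ { (inj₁ (Y∈M , _)) → inj₁ Y∈M ; (inj₂ (_ , Y∈/)) → inj₂ (proj₂ (∈-/ᵖ⇒∈-* Y∈/)) }
    ; M∖N⊆E  = λ _ Y∈M Y∉N → inj₁ (Y∈M , Y∉N ∘ proj₂ ∘ ∈-/ᵖ⇒∈-*)
    ; N∖M⊆E  = λ v∉Y Y∈N Y∉M → inj₂ (Y∉M , ∈-*⇒∈-/ᵖ v∉Y Y∈N)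
    }

  open PivotTriple pivotTriple

  split-≡ : IsDeltaMatroid M → LowestAt M k → LowestAt N k → LowestAt E e →
            LayersSplit v M k N k E e
  split-≡ {k} {e} δ lowM@((X , X∈M , X≡k) , k≤M) lowN@(_ , k≤N) lowE = record
    { heights = refl
    ; layers  = M⊆N , N⊆M
    ; above   = e≡1+k
    ; removed = removed-≐
        -- A member of `E` containing `v` comes from `M`; deleting `v` lands in the lowest layer of
        -- `N`, which is that of `M`.
        (λ { {Z} (Z∈E , Z≡e) v∈Z → N⊆M
          ( pivot (E∋v⇒M v∈Z Z∈E)
          , suc-injective (trans (∣p△⁅x⁆∣-∈ v∈Z) (trans Z≡e e≡1+k))) })
        (λ Y → let Y△v∈E , Y△v≡1+k = raise Y in ∌v Y , Y△v∈E , trans Y△v≡1+k (sym e≡1+k))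
    }
    where
    M⊆N : ∀ {Y} → Layer M k Y → Layer N k Y
    M⊆N Y@(_ , Y≡k) = layer-⊆ pivotTriple (*-isDeltaMatroid δ v) lowM lowN Y , Y≡k
    N⊆M : ∀ {Y} → Layer N k Y → Layer M k Y
    N⊆M Y@(_ , Y≡k) = layer-⊆ flip δ lowN lowM Y , Y≡k
    ∌v : ∀ {Y} → Layer M k Y → v ∉ Y
    ∌v (Y∈M , Y≡k) = lowest-∌v pivotTriple k≤N Y∈M (≤-reflexive Y≡k)
    E∋v⇒M : ∀ {Y} → v ∈ Y → Y ∈ˢ E → Y ∈ˢ M
    E∋v⇒M v∈Y (inj₁ (Y∈M , _)) = Y∈M
    E∋v⇒M v∈Y (inj₂ (_ , Y∈/)) = contradiction v∈Y (proj₁ (∈-/ᵖ⇒∈-* Y∈/))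
    -- `Y` also lies in `N`, so adding `v` gives a member of `M`. Containing `v`, it is not in
    -- `M /ᵖ v` and survives in `E`.
    raise : ∀ {Y} → Layer M k Y → Layer E (suc k) (Y △ ⁅ v ⁆)
    raise Y@(Y∈M , Y≡k) =
      inj₁ (pivot⁻ (proj₁ (M⊆N Y)) , λ Y△v∈/ → proj₁ (∈-/ᵖ⇒∈-* Y△v∈/) (x∉p⇒x∈p△⁅x⁆ (∌v Y))) ,
      trans (∣p△⁅x⁆∣-∉ (∌v Y)) (cong suc Y≡k)
    -- A set of size `k` in either `M` or `M /ᵖ v` lies in both, hence cancels.
    k<E : ∀ {Y} → Y ∈ˢ E → k < ∣ Y ∣
    k<E {Y} (inj₁ (Y∈M , Y∉/)) = ≤∧≢⇒< (k≤M Y∈M) λ k≡Y → let Y′ = Y∈M , sym k≡Y in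
      Y∉/ (∈-*⇒∈-/ᵖ (∌v Y′) (proj₁ (M⊆N Y′)))
    k<E {Y} (inj₂ (Y∉M , Y∈/)) = ≤∧≢⇒< (k≤N Y∈N) λ k≡Y → Y∉M (proj₁ (N⊆M (Y∈N , sym k≡Y)))
      where
      Y∈N = proj₂ (∈-/ᵖ⇒∈-* Y∈/)
    e≡1+k : e ≡ suc k
    e≡1+k = lowestAt-unique {M = E} lowE ((X △ ⁅ v ⁆ , raise (X∈M , X≡k)) , k<E)

  layersSplit : IsDeltaMatroid M → LowestAt M m → LowestAt N l → LowestAt E e →
                LayersSplit v M m N l E e ⊎ LayersSplit v M m E e N l ⊎ LayersSplit v N l E e M m
  layersSplit {m} {l} δ lowM lowN lowE with <-cmp m l
  ... | tri< m<l _ _  = inj₂ (inj₁ (split-< pivotTriple lowM lowN lowE m<l))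
  ... | tri≈ _ refl _ = inj₁ (split-≡ δ lowM lowN lowE)
  -- Exchanging `M` and `N` reduces this to the first case.
  ... | tri> _ _ l<m  = inj₂ (inj₂ (split-< flip lowN lowM lowE l<m))

theorem5p5 : ∀ {n : ℕ} (M : SetSystem n) (δ : IsDeltaMatroid M) (v : Fin n) →
    let p   = IsDeltaMatroid.proper δ
        p*  = *-proper M v p
        p*ᵈ = *ᵈ-proper M v p
    in
    (Equicardinal (min M) × Equicardinal (min (M * v)) × Equicardinal (minc (M *ᵈ v)))
    × PreciselyTwoEqual _≈ᵖ_ (LiesAbove v)
        ⟨ min M           , min-proper M p ⟩
        ⟨ min (M * v)     , min-proper (M * v) p* ⟩
        ⟨ minc (M *ᵈ v)   , minc-proper (M *ᵈ v) p*ᵈ ⟩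
    × PreciselyTwoEqual _≡_ (λ m k → k ≡ suc m)
        (d M p) (d (M * v) p*) (d (M *ᵈ v) p*ᵈ)
theorem5p5 M δ v =
  ( layer⇒equicardinal {M = M} {S = min M} S≐
  , layer⇒equicardinal {M = N} {S = min N} T≐
  , layer⇒equicardinal {M = E} {S = minc E} U≐
  ) ,
  (case layersSplit M v δ lowM lowN lowE of λ where
    (inj₁ s)        → inj₁ (systems-split s S T U S≐ lowM T≐ lowN U≐ lowE)
    (inj₂ (inj₁ s)) → inj₂ (inj₁ (systems-split s S U T S≐ lowM U≐ lowE T≐ lowN))
    (inj₂ (inj₂ s)) → inj₂ (inj₂ (systems-split s T U S T≐ lowN U≐ lowE S≐ lowM))) ,
  -- The heights in `lowM`, `lowN` and `lowE` are the values of `d` themselves, so the same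
  -- trichotomy settles the numerical claim.
  (case layersSplit M v δ lowM lowN lowE of λ where
    (inj₁ s)        → inj₁ (heights-split s)
    (inj₂ (inj₁ s)) → inj₂ (inj₁ (heights-split s))
    (inj₂ (inj₂ s)) → inj₂ (inj₂ (heights-split s)))
  where
  open LayersSplit
  N = M * v
  E = M *ᵈ v
  pᴹ = IsDeltaMatroid.proper δ
  p* = *-proper M v pᴹ
  pᵈ = *ᵈ-proper M v pᴹ
  S = ⟨ min M , min-proper M pᴹ ⟩
  T = ⟨ min N , min-proper N p* ⟩
  U = ⟨ minc E , minc-proper E pᵈ ⟩
  lowM = lowestAt-d M pᴹ
  lowN = lowestAt-d N p*
  lowE = lowestAt-d E pᵈ
  S≐ = min-layer δ lowM
  T≐ = min-layer (*-isDeltaMatroid δ v) lowN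
  U≐ = minc-layer {M = E} lowE
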